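{- Let $C_0$ be a Cartesian category with a strong monad $(M,\mu,\eta,t)$ such that every $\eta_X$ is a monomorphism, let $K$ be the Kleisli category of $M$, $J:C_0\to K$ the canonical functor and $C=J(C_0)$, and let $\lhd$ be a consistency relation on $C\subseteq K$. Then $(C\subseteq K,\lhd)$ with the left and right Kleisli products is a weak Cartesian effect category if and only if for all objects $Y_1,Y_2$ (with projections $q_1:Y_1\times Y_2\to Y_1$ and $q'_1:Y_1\times MY_2\to Y_1$) $$ q_1\circ\,]t_{Y_1,Y_2}[\;\lhd\; q'_1 \text{ in } K,\qquad\text{or equivalently}\qquad Mq_1\circ t_{Y_1,Y_2}\;\lhd_0\;\eta_{Y_1}\circ q'_1 \text{ in } C_0 .$$ If in addition, for all objects $X,Y_1,Y_2$ and all $\varphi,\varphi':X\to M(Y_1\times Y_2)$ in $C_0$ (with projections $q_i:Y_1\times Y_2\to Y_i$), $$ \big(Mq_1\circ\varphi\;\lhd\rhd_0\;Mq_1\circ\varphi'\big)\wedge\big(Mq_2\circ\varphi=Mq_2\circ\varphi'\big)\implies\varphi=\varphi',$$ then $(C\subseteq K,\lhd)$ with the left and right Kleisli products is a Cartesian effect category.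
   Context: **Kleisli category.** A Cartesian category is a category with chosen finite products (terminal object $1$, binary products $\times$). The Kleisli category $K$ of $M$ has the objects of $C_0$, and $K(X,Y)$ is in bijection with $C_0(X,MY)$: for $f:X\to Y$ in $K$ the corresponding morphism of $C_0$ is written $[f]:X\to MY$, and for $\varphi:X\to MY$ in $C_0$ the corresponding morphism of $K$ is written $]\varphi[:X\to Y$. Identities are $[\mathrm{id}_X]=\eta_X$ and composition is $[g\circ f]=\mu_Z\circ M[g]\circ[f]$ for $f:X\to Y$, $g:Y\to Z$. The functor $J:C_0\to K$ is the identity on objects with $[J(v_0)]=\eta_Y\circ v_0$ for $v_0:X\to Y$; since every $\eta_X$ is mono, $J$ is faithful and gives an isomorphism $C_0\cong C=J(C_0)$. Morphisms of $C$ are called pure, and each pure $v$ is $J(v_0)$ for a unique $v_0$. Via this isomorphism $C$ is Cartesian; projections of $C_0$ and the corresponding pure projections in $K$ are given the same names. **Strength.** A strong monad is a monad with a strength: a natural transformation $t_{Y_1,Y_2}:Y_1\times MY_2\to M(Y_1\times Y_2)$ satisfying Moggi's four (standard) axioms: compatibility with the left unit isomorphism $r_X:1\times X\to X$ ($Mr_X\circ t_{1,X}=r_{MX}$), with associativity of $\times$, with $\eta$, and with $\mu$. **Kleisli products.** For pure $v=J(v_0):X_1\to Y_1$ and $f:X_2\to Y_2$ in $K$, the left Kleisli product $v\ltimes_{\mathrm{Kl}}f:X_1\times X_2\to Y_1\times Y_2$ in $K$ is given by $[v\ltimes_{\mathrm{Kl}}f]=t_{Y_1,Y_2}\circ(v_0\times[f])$.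 The right Kleisli product $f\rtimes_{\mathrm{Kl}}v$ ($f:X_1\to Y_1$ in $K$, $v=J(v_0):X_2\to Y_2$ pure) is defined symmetrically: $[f\rtimes_{\mathrm{Kl}}v]=t'_{Y_1,Y_2}\circ([f]\times v_0)$, where $t'_{Y_1,Y_2}:MY_1\times Y_2\to M(Y_1\times Y_2)$ is obtained from $t_{Y_2,Y_1}$ by conjugating with the swap isomorphisms of $\times$. **Consistency relations.** Here $C$ is a wide subcategory of $K$ (same objects). A consistency relation $\lhd$ on $C\subseteq K$ is a relation between parallel morphisms of $K$, the second one being pure, such that (i) $v\lhd v$ for every pure $v$; (ii) for all $f:X\to Y$, $g:Y\to Z$ in $K$ and pure $u:Y\to Y'$, $v:X\to Y'$, $w:Y'\to Z$, if $u\circ f\lhd v$ and $g\lhd w\circ u$ then $g\circ f\lhd w\circ v$. Write $f\lhd\rhd f'$ iff there is a pure $v$ with $f\lhd v$ and $f'\lhd v$. **Relations in $C_0$.** For $\varphi,\varphi':X\to MY$ in $C_0$: $\varphi\lhd_0\varphi'$ iff there is $v_0:X\to Y$ in $C_0$ with $\varphi'=\eta_Y\circ v_0$ and $]\varphi[\;\lhd J(v_0)$. And $\varphi\lhd\rhd_0\varphi'$ iff $]\varphi[\;\lhd\rhd\;]\varphi'[$, i.e. iff there is $\psi$ with $\varphi\lhd_0\psi$ and $\varphi'\lhd_0\psi$. **Effect categories.** An object $1$ terminal in $C$ is called pure terminal, and $\langle\,\rangle_X:X\to 1$ denotes the unique pure morphism. For $f:X\to Y$, $f':X\to Y'$ in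 $K$, $f\approx f'$ iff $\langle\,\rangle_Y\circ f=\langle\,\rangle_{Y'}\circ f'$. An effect category $(C\subseteq K,\lhd)$ is a category $K$ with a wide subcategory $C$, a pure terminal object and a consistency relation $\lhd$ satisfying complementarity: for parallel $f,f'$, $f\approx f'$ and $f\lhd\rhd f'$ imply $f=f'$. **(Weak) Cartesian effect categories.** Graph homomorphisms $\ltimes:C\times K\to K$ and $\rtimes:K\times C\to K$ considered here send $(X_1,X_2)$ to $X_1\times X_2$ on objects. Write $p_i:X_1\times X_2\to X_i$, $q_i:Y_1\times Y_2\to Y_i$ for the projections. A weak Cartesian effect category is an effect category $(C\subseteq K,\lhd)$ with $C$ Cartesian, together with such $\ltimes$ and $\rtimes$ satisfying the following, where the morphisms with these properties need not be unique: for all pure $v_1:X_1\to Y_1$ and $f_2:X_2\to Y_2$ in $K$, $q_1\circ(v_1\ltimes f_2)\lhd v_1\circ p_1$ and $q_2\circ(v_1\ltimes f_2)=f_2\circ p_2$; and for all $f_1:X_1\to Y_1$ in $K$ and pure $v_2:X_2\to Y_2$, $q_1\circ(f_1\rtimes v_2)=f_1\circ p_1$ and $q_2\circ(f_1\rtimes v_2)\lhd v_2\circ p_2$. It is a Cartesian effect category if in addition $\ltimes$ and $\rtimes$ extend $\times$ on pairs of pure morphisms, and $v_1\ltimes f_2$ and $f_1\rtimes v_2$ are the unique morphisms of $K$ with the respective properties.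
   Formalization: Complementarity does not follow from the strength condition, so the first equivalence is proved assuming that (C⊆K,◁) is an effect category and, for any consistency relation, with complementarity dropped from the definition of weak Cartesian effect category. -}

module Defs where

open import Level using (Level; _⊔_; suc)
open import Data.Product using (Σ; Σ-syntax; ∃-syntax; _,_; proj₁; proj₂; _×_)
open import Function.Base using (_on_)
open import Relation.Binary.Core using (Rel)
open import Relation.Binary.Bundles using (Setoid)
open import Relation.Binary.Structures using (IsEquivalence)
import Relation.Binary.Reasoning.Setoid as SetoidReasoning

-- Hom-sets are setoids: equality of morphisms is the field `_≈_`, and every
-- operation or relation on morphisms below is required to respect it.

record Category (o ℓ e : Level) : Set (suc (o ⊔ ℓ ⊔ e)) where
  infix  4 _≈_
  infixr 9 _∘_
  field
    Obj       : Set o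
    Hom       : Obj → Obj → Set ℓ
    _≈_       : ∀ {X Y} → Rel (Hom X Y) e
    id        : ∀ {X} → Hom X X
    _∘_       : ∀ {X Y Z} → Hom Y Z → Hom X Y → Hom X Z
    ≈-equiv   : ∀ {X Y} → IsEquivalence (_≈_ {X} {Y})
    ∘-cong    : ∀ {X Y Z} {g g′ : Hom Y Z} {f f′ : Hom X Y} →
                g ≈ g′ → f ≈ f′ → g ∘ f ≈ g′ ∘ f′
    assoc     : ∀ {W X Y Z} {h : Hom Y Z} {g : Hom X Y} {f : Hom W X} →
                (h ∘ g) ∘ f ≈ h ∘ (g ∘ f)
    identityˡ : ∀ {X Y} {f : Hom X Y} → id ∘ f ≈ f
    identityʳ : ∀ {X Y} {f : Hom X Y} → f ∘ id ≈ f

  module _ {X Y : Obj} where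
    open IsEquivalence (≈-equiv {X} {Y}) public
      renaming (refl to ≈-refl; sym to ≈-sym; trans to ≈-trans)
      using ()

  hom-setoid : Obj → Obj → Setoid ℓ e
  hom-setoid X Y = record { Carrier = Hom X Y ; _≈_ = _≈_ ; isEquivalence = ≈-equiv }

  module HomReasoning {X Y : Obj} = SetoidReasoning (hom-setoid X Y)

  Mono : ∀ {X Y} → Hom X Y → Set (o ⊔ ℓ ⊔ e)
  Mono {X} m = ∀ {W} (f g : Hom W X) → m ∘ f ≈ m ∘ g → f ≈ g

record Functor {o ℓ e o′ ℓ′ e′ : Level} (C : Category o ℓ e) (D : Category o′ ℓ′ e′)
  : Set (o ⊔ ℓ ⊔ e ⊔ o′ ⊔ ℓ′ ⊔ e′) where
  private
    module C = Category C
    module D = Category D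
  field
    F₀     : C.Obj → D.Obj
    F₁     : ∀ {X Y} → C.Hom X Y → D.Hom (F₀ X) (F₀ Y)
    F-cong : ∀ {X Y} {f g : C.Hom X Y} → f C.≈ g → F₁ f D.≈ F₁ g
    F-id   : ∀ {X} → F₁ (C.id {X}) D.≈ D.id
    F-∘    : ∀ {X Y Z} {g : C.Hom Y Z} {f : C.Hom X Y} → F₁ (g C.∘ f) D.≈ F₁ g D.∘ F₁ f

record Terminal {o ℓ e : Level} (C : Category o ℓ e) : Set (o ⊔ ℓ ⊔ e) where
  open Category C
  field
    𝟙        : Obj
    !        : ∀ {X} → Hom X 𝟙
    !-unique : ∀ {X} (f : Hom X 𝟙) → ! ≈ f

record Cartesian {o ℓ e : Level} (C : Category o ℓ e) : Set (o ⊔ ℓ ⊔ e) where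
  open Category C
  infixr 7 _⊗_ _⊗₁_
  field
    terminal : Terminal C
    _⊗_      : Obj → Obj → Obj
    π₁       : ∀ {X Y} → Hom (X ⊗ Y) X
    π₂       : ∀ {X Y} → Hom (X ⊗ Y) Y
    ⟨_,_⟩    : ∀ {X Y Z} → Hom Z X → Hom Z Y → Hom Z (X ⊗ Y)
    project₁ : ∀ {X Y Z} {f : Hom Z X} {g : Hom Z Y} → π₁ ∘ ⟨ f , g ⟩ ≈ f
    project₂ : ∀ {X Y Z} {f : Hom Z X} {g : Hom Z Y} → π₂ ∘ ⟨ f , g ⟩ ≈ g
    unique   : ∀ {X Y Z} {f : Hom Z X} {g : Hom Z Y} {h : Hom Z (X ⊗ Y)} →
               π₁ ∘ h ≈ f → π₂ ∘ h ≈ g → ⟨ f , g ⟩ ≈ h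

  open Terminal terminal public

  _⊗₁_ : ∀ {X₁ X₂ Y₁ Y₂} → Hom X₁ Y₁ → Hom X₂ Y₂ → Hom (X₁ ⊗ X₂) (Y₁ ⊗ Y₂)
  f ⊗₁ g = ⟨ f ∘ π₁ , g ∘ π₂ ⟩

  swap : ∀ {X Y} → Hom (X ⊗ Y) (Y ⊗ X)
  swap = ⟨ π₂ , π₁ ⟩

  unitorˡ : ∀ {X} → Hom (𝟙 ⊗ X) X
  unitorˡ = π₂

  associator : ∀ {X Y Z} → Hom ((X ⊗ Y) ⊗ Z) (X ⊗ (Y ⊗ Z))
  associator = ⟨ π₁ ∘ π₁ , ⟨ π₂ ∘ π₁ , π₂ ⟩ ⟩

  ⟨⟩-cong : ∀ {X Y Z} {f f′ : Hom Z X} {g g′ : Hom Z Y} →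
            f ≈ f′ → g ≈ g′ → ⟨ f , g ⟩ ≈ ⟨ f′ , g′ ⟩
  ⟨⟩-cong p q = unique (≈-trans project₁ (≈-sym p)) (≈-trans project₂ (≈-sym q))

  ⊗₁-cong : ∀ {X₁ X₂ Y₁ Y₂} {f f′ : Hom X₁ Y₁} {g g′ : Hom X₂ Y₂} →
            f ≈ f′ → g ≈ g′ → f ⊗₁ g ≈ f′ ⊗₁ g′
  ⊗₁-cong p q = ⟨⟩-cong (∘-cong p ≈-refl) (∘-cong q ≈-refl)

record Monad {o ℓ e : Level} (C : Category o ℓ e) : Set (o ⊔ ℓ ⊔ e) where
  open Category C
  field
    functor : Functor C C
  open Functor functor public
    renaming (F₀ to M₀; F₁ to M₁; F-cong to M-cong; F-id to M-id; F-∘ to M-∘)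
  field
    η         : ∀ X → Hom X (M₀ X)
    μ         : ∀ X → Hom (M₀ (M₀ X)) (M₀ X)
    η-natural : ∀ {X Y} (f : Hom X Y) → η Y ∘ f ≈ M₁ f ∘ η X
    μ-natural : ∀ {X Y} (f : Hom X Y) → μ Y ∘ M₁ (M₁ f) ≈ M₁ f ∘ μ X
    μ-assoc   : ∀ {X} → μ X ∘ M₁ (μ X) ≈ μ X ∘ μ (M₀ X)
    μ-unitˡ   : ∀ {X} → μ X ∘ M₁ (η X) ≈ id
    μ-unitʳ   : ∀ {X} → μ X ∘ η (M₀ X) ≈ id

record StrongMonad {o ℓ e : Level} {C : Category o ℓ e} (cartesian : Cartesian C)
  : Set (o ⊔ ℓ ⊔ e) where
  open Category C
  open Cartesian cartesian
  field
    monad : Monad C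
  open Monad monad public
  field
    t         : ∀ Y₁ Y₂ → Hom (Y₁ ⊗ M₀ Y₂) (M₀ (Y₁ ⊗ Y₂))
    t-natural : ∀ {X₁ X₂ Y₁ Y₂} (f : Hom X₁ Y₁) (g : Hom X₂ Y₂) →
                t Y₁ Y₂ ∘ (f ⊗₁ M₁ g) ≈ M₁ (f ⊗₁ g) ∘ t X₁ X₂
    t-unit    : ∀ {X} → M₁ (unitorˡ {X}) ∘ t 𝟙 X ≈ unitorˡ {M₀ X}
    t-assoc   : ∀ {X Y Z} →
                M₁ (associator {X} {Y} {Z}) ∘ t (X ⊗ Y) Z
                  ≈ t X (Y ⊗ Z) ∘ (id ⊗₁ t Y Z) ∘ associator
    t-η       : ∀ {X Y} → t X Y ∘ (id ⊗₁ η Y) ≈ η (X ⊗ Y)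
    t-μ       : ∀ {X Y} → t X Y ∘ (id ⊗₁ μ Y) ≈ μ (X ⊗ Y) ∘ M₁ (t X Y) ∘ t X (M₀ Y)

  t′ : ∀ Y₁ Y₂ → Hom (M₀ Y₁ ⊗ Y₂) (M₀ (Y₁ ⊗ Y₂))
  t′ Y₁ Y₂ = M₁ swap ∘ t Y₂ Y₁ ∘ swap

record WideSubcategory {o ℓ e : Level} (K : Category o ℓ e) (p : Level)
  : Set (o ⊔ ℓ ⊔ e ⊔ suc p) where
  open Category K
  field
    Pure      : ∀ {X Y} → Hom X Y → Set p
    pure-resp : ∀ {X Y} {f g : Hom X Y} → f ≈ g → Pure f → Pure g
    pure-id   : ∀ {X} → Pure (id {X})
    pure-∘    : ∀ {X Y Z} {g : Hom Y Z} {f : Hom X Y} → Pure g → Pure f → Pure (g ∘ f)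

  category : Category o (ℓ ⊔ p) e
  category = record
    { Obj       = Obj
    ; Hom       = λ X Y → Σ (Hom X Y) Pure
    ; _≈_       = _≈_ on proj₁
    ; id        = id , pure-id
    ; _∘_       = λ (g , pg) (f , pf) → g ∘ f , pure-∘ pg pf
    ; ≈-equiv   = record { refl = ≈-refl ; sym = ≈-sym ; trans = ≈-trans }
    ; ∘-cong    = ∘-cong
    ; assoc     = assoc
    ; identityˡ = identityˡ
    ; identityʳ = identityʳ
    }

  ι : ∀ {X Y} → Category.Hom category X Y → Hom X Y
  ι = proj₁

record ConsistencyRelation {o ℓ e p : Level} {K : Category o ℓ e}
  (C : WideSubcategory K p) (r : Level) : Set (o ⊔ ℓ ⊔ e ⊔ p ⊔ suc r) where
  open Category K
  open WideSubcategory C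
  infix 4 _◁_ _◁▷_
  field
    _◁_    : ∀ {X Y} → Hom X Y → Hom X Y → Set r
    ◁-resp : ∀ {X Y} {f f′ v v′ : Hom X Y} → f ≈ f′ → v ≈ v′ → f ◁ v → f′ ◁ v′
    ◁-pure : ∀ {X Y} {f v : Hom X Y} → f ◁ v → Pure v
    ◁-refl : ∀ {X Y} {v : Hom X Y} → Pure v → v ◁ v
    ◁-∘    : ∀ {X Y Y′ Z} {f : Hom X Y} {g : Hom Y Z}
             {u : Hom Y Y′} {v : Hom X Y′} {w : Hom Y′ Z} →
             Pure u → Pure v → Pure w →
             u ∘ f ◁ v → g ◁ w ∘ u → g ∘ f ◁ w ∘ v

  _◁▷_ : ∀ {X Y} → Hom X Y → Hom X Y → Set (ℓ ⊔ p ⊔ r)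
  f ◁▷ f′ = ∃[ v ] Pure v × f ◁ v × f′ ◁ v

module _ {o ℓ e p r : Level} {K : Category o ℓ e} (C : WideSubcategory K p)
  (pureTerminal : Terminal (WideSubcategory.category C)) (consistency : ConsistencyRelation C r) where

  open Category K
  open WideSubcategory C using (ι)
  open Terminal pureTerminal
  open ConsistencyRelation consistency

  -- The relation between f : X → Y and f′ : X → Y′ usually written f ≈ f′;
  -- the symbol ≈ is taken by equality of morphisms.
  SameEffect : ∀ {X Y Y′} → Hom X Y → Hom X Y′ → Set e
  SameEffect f f′ = ι ! ∘ f ≈ ι ! ∘ f′

  record IsEffectCategory : Set (o ⊔ ℓ ⊔ e ⊔ p ⊔ r) where
    field
      complementarity : ∀ {X Y} (f f′ : Hom X Y) → SameEffect f f′ → f ◁▷ f′ → f ≈ f′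

module _ {o ℓ e p : Level} {K : Category o ℓ e} (C : WideSubcategory K p)
  (cartesian : Cartesian (WideSubcategory.category C)) where

  private
    module K = Category K
    module C = Category (WideSubcategory.category C)
  open Cartesian cartesian using (_⊗_)

  -- Graph homomorphisms C × K → K and K × C → K, given on objects by the
  -- product of C.

  record LeftProduct : Set (o ⊔ ℓ ⊔ e ⊔ p) where
    infix 8 _⋉_
    field
      _⋉_    : ∀ {X₁ X₂ Y₁ Y₂} → C.Hom X₁ Y₁ → K.Hom X₂ Y₂ → K.Hom (X₁ ⊗ X₂) (Y₁ ⊗ Y₂)
      ⋉-cong : ∀ {X₁ X₂ Y₁ Y₂} {v v′ : C.Hom X₁ Y₁} {f f′ : K.Hom X₂ Y₂} →
               v C.≈ v′ → f K.≈ f′ → v ⋉ f K.≈ v′ ⋉ f′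

  record RightProduct : Set (o ⊔ ℓ ⊔ e ⊔ p) where
    infix 8 _⋊_
    field
      _⋊_    : ∀ {X₁ X₂ Y₁ Y₂} → K.Hom X₁ Y₁ → C.Hom X₂ Y₂ → K.Hom (X₁ ⊗ X₂) (Y₁ ⊗ Y₂)
      ⋊-cong : ∀ {X₁ X₂ Y₁ Y₂} {f f′ : K.Hom X₁ Y₁} {v v′ : C.Hom X₂ Y₂} →
               f K.≈ f′ → v C.≈ v′ → f ⋊ v K.≈ f′ ⋊ v′

module _ {o ℓ e p r : Level} {K : Category o ℓ e} (C : WideSubcategory K p)
  (cartesian : Cartesian (WideSubcategory.category C)) (consistency : ConsistencyRelation C r)
  (leftProduct : LeftProduct C cartesian) (rightProduct : RightProduct C cartesian) where

  private
    module C = Category (WideSubcategory.category C)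
  open Category K
  open WideSubcategory C using (ι)
  open Cartesian cartesian using (_⊗_; _⊗₁_; π₁; π₂; terminal)
  open ConsistencyRelation consistency
  open LeftProduct leftProduct
  open RightProduct rightProduct

  IsLeftProductOf : ∀ {X₁ X₂ Y₁ Y₂} → C.Hom X₁ Y₁ → Hom X₂ Y₂ →
                    Hom (X₁ ⊗ X₂) (Y₁ ⊗ Y₂) → Set (e ⊔ r)
  IsLeftProductOf v₁ f₂ h = (ι π₁ ∘ h ◁ ι v₁ ∘ ι π₁) × (ι π₂ ∘ h ≈ f₂ ∘ ι π₂)

  IsRightProductOf : ∀ {X₁ X₂ Y₁ Y₂} → Hom X₁ Y₁ → C.Hom X₂ Y₂ →
                     Hom (X₁ ⊗ X₂) (Y₁ ⊗ Y₂) → Set (e ⊔ r)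
  IsRightProductOf f₁ v₂ h = (ι π₁ ∘ h ≈ f₁ ∘ ι π₁) × (ι π₂ ∘ h ◁ ι v₂ ∘ ι π₂)

  -- The conditions on ⋉ and ⋊ in a weak Cartesian effect category, without
  -- complementarity (which mentions neither ⋉ nor ⋊).
  record AreWeakProducts : Set (o ⊔ ℓ ⊔ e ⊔ p ⊔ r) where
    field
      ⋉-isProduct : ∀ {X₁ X₂ Y₁ Y₂} (v₁ : C.Hom X₁ Y₁) (f₂ : Hom X₂ Y₂) →
                    IsLeftProductOf v₁ f₂ (v₁ ⋉ f₂)
      ⋊-isProduct : ∀ {X₁ X₂ Y₁ Y₂} (f₁ : Hom X₁ Y₁) (v₂ : C.Hom X₂ Y₂) →
                    IsRightProductOf f₁ v₂ (f₁ ⋊ v₂)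

  record IsWeakCartesianEffectCategory : Set (o ⊔ ℓ ⊔ e ⊔ p ⊔ r) where
    field
      isEffectCategory : IsEffectCategory C terminal consistency
      areWeakProducts  : AreWeakProducts

  record IsCartesianEffectCategory : Set (o ⊔ ℓ ⊔ e ⊔ p ⊔ r) where
    field
      isWeakCartesianEffectCategory : IsWeakCartesianEffectCategory
      ⋉-extends-⊗ : ∀ {X₁ X₂ Y₁ Y₂} (v₁ : C.Hom X₁ Y₁) (v₂ : C.Hom X₂ Y₂) →
                    v₁ ⋉ ι v₂ ≈ ι (v₁ ⊗₁ v₂)
      ⋊-extends-⊗ : ∀ {X₁ X₂ Y₁ Y₂} (v₁ : C.Hom X₁ Y₁) (v₂ : C.Hom X₂ Y₂) →
                    ι v₁ ⋊ v₂ ≈ ι (v₁ ⊗₁ v₂)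
      ⋉-unique    : ∀ {X₁ X₂ Y₁ Y₂} (v₁ : C.Hom X₁ Y₁) (f₂ : Hom X₂ Y₂)
                    (h : Hom (X₁ ⊗ X₂) (Y₁ ⊗ Y₂)) → IsLeftProductOf v₁ f₂ h → h ≈ v₁ ⋉ f₂
      ⋊-unique    : ∀ {X₁ X₂ Y₁ Y₂} (f₁ : Hom X₁ Y₁) (v₂ : C.Hom X₂ Y₂)
                    (h : Hom (X₁ ⊗ X₂) (Y₁ ⊗ Y₂)) → IsRightProductOf f₁ v₂ h → h ≈ f₁ ⋊ v₂

module Kleisli {o ℓ e : Level} {C₀ : Category o ℓ e} (monad : Monad C₀) where

  open Category C₀
  open Monad monad

  -- ⟧ φ ⟦ is the Kleisli morphism corresponding to φ, usually written ]φ[.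
  record KleisliHom (X Y : Obj) : Set ℓ where
    constructor ⟧_⟦
    field
      [_] : Hom X (M₀ Y)
  open KleisliHom public

  K : Category o ℓ e
  K = record
    { Obj       = Obj
    ; Hom       = KleisliHom
    ; _≈_       = _≈_ on [_]
    ; id        = ⟧ η _ ⟦
    ; _∘_       = λ g f → ⟧ μ _ ∘ M₁ [ g ] ∘ [ f ] ⟦
    ; ≈-equiv   = record { refl = ≈-refl ; sym = ≈-sym ; trans = ≈-trans }
    ; ∘-cong    = λ p q → ∘-cong ≈-refl (∘-cong (M-cong p) q)
    ; assoc     = λ {_} {_} {_} {_} {h} {g} {f} → K-assoc [ h ] [ g ] [ f ]
    ; identityˡ = ≈-trans (≈-sym assoc) (≈-trans (∘-cong μ-unitˡ ≈-refl) identityˡ)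
    ; identityʳ = λ {_} {_} {f} → K-identityʳ [ f ]
    }
    where
    open HomReasoning

    K-identityʳ : ∀ {X Y} (f : Hom X (M₀ Y)) → μ Y ∘ M₁ f ∘ η X ≈ f
    K-identityʳ {X} {Y} f = begin
      μ Y ∘ M₁ f ∘ η X     ≈⟨ ∘-cong ≈-refl (η-natural f) ⟨
      μ Y ∘ η (M₀ Y) ∘ f   ≈⟨ assoc ⟨
      (μ Y ∘ η (M₀ Y)) ∘ f ≈⟨ ∘-cong μ-unitʳ ≈-refl ⟩
      id ∘ f               ≈⟨ identityˡ ⟩
      f                    ∎

    K-assoc : ∀ {W X Y Z} (h : Hom Y (M₀ Z)) (g : Hom X (M₀ Y)) (f : Hom W (M₀ X)) →
              μ Z ∘ M₁ (μ Z ∘ M₁ h ∘ g) ∘ f ≈ μ Z ∘ M₁ h ∘ (μ Y ∘ M₁ g ∘ f)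
    K-assoc {W} {X} {Y} {Z} h g f = begin
      μ Z ∘ M₁ (μ Z ∘ M₁ h ∘ g) ∘ f
        ≈⟨ ∘-cong ≈-refl (∘-cong (≈-trans M-∘ (∘-cong ≈-refl M-∘)) ≈-refl) ⟩
      μ Z ∘ (M₁ (μ Z) ∘ M₁ (M₁ h) ∘ M₁ g) ∘ f
        ≈⟨ ∘-cong ≈-refl (≈-trans assoc (∘-cong ≈-refl assoc)) ⟩
      μ Z ∘ M₁ (μ Z) ∘ M₁ (M₁ h) ∘ M₁ g ∘ f
        ≈⟨ assoc ⟨
      (μ Z ∘ M₁ (μ Z)) ∘ M₁ (M₁ h) ∘ M₁ g ∘ f
        ≈⟨ ∘-cong μ-assoc ≈-refl ⟩
      (μ Z ∘ μ (M₀ Z)) ∘ M₁ (M₁ h) ∘ M₁ g ∘ f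
        ≈⟨ assoc ⟩
      μ Z ∘ μ (M₀ Z) ∘ M₁ (M₁ h) ∘ M₁ g ∘ f
        ≈⟨ ∘-cong ≈-refl assoc ⟨
      μ Z ∘ (μ (M₀ Z) ∘ M₁ (M₁ h)) ∘ M₁ g ∘ f
        ≈⟨ ∘-cong ≈-refl (∘-cong (μ-natural h) ≈-refl) ⟩
      μ Z ∘ (M₁ h ∘ μ Y) ∘ M₁ g ∘ f
        ≈⟨ ∘-cong ≈-refl assoc ⟩
      μ Z ∘ M₁ h ∘ (μ Y ∘ M₁ g ∘ f) ∎

  private
    module K = Category K

  J-functor : Functor C₀ K
  J-functor = record
    { F₀     = λ X → X
    ; F₁     = λ {_} {Y} v₀ → ⟧ η Y ∘ v₀ ⟦
    ; F-cong = ∘-cong ≈-refl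
    ; F-id   = identityʳ
    ; F-∘    = λ {_} {_} {_} {g₀} {f₀} → J-∘ g₀ f₀
    }
    where
    open HomReasoning

    J-∘ : ∀ {X Y Z} (g₀ : Hom Y Z) (f₀ : Hom X Y) →
          η Z ∘ g₀ ∘ f₀ ≈ μ Z ∘ M₁ (η Z ∘ g₀) ∘ η Y ∘ f₀
    J-∘ {X} {Y} {Z} g₀ f₀ = begin
      η Z ∘ g₀ ∘ f₀                       ≈⟨ assoc ⟨
      (η Z ∘ g₀) ∘ f₀                     ≈⟨ ∘-cong (K.identityʳ {f = ⟧ η Z ∘ g₀ ⟦}) ≈-refl ⟨
      (μ Z ∘ M₁ (η Z ∘ g₀) ∘ η Y) ∘ f₀    ≈⟨ assoc ⟩
      μ Z ∘ (M₁ (η Z ∘ g₀) ∘ η Y) ∘ f₀    ≈⟨ ∘-cong ≈-refl assoc ⟩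
      μ Z ∘ M₁ (η Z ∘ g₀) ∘ η Y ∘ f₀      ∎

  J : ∀ {X Y} → Hom X Y → K.Hom X Y
  J = Functor.F₁ J-functor

  open Functor J-functor using () renaming (F-cong to J-cong; F-id to J-id; F-∘ to J-∘) public

  C : WideSubcategory K (ℓ ⊔ e)
  C = record
    { Pure      = λ f → ∃[ v₀ ] J v₀ K.≈ f
    ; pure-resp = λ f≈g (v₀ , p) → v₀ , ≈-trans p f≈g
    ; pure-id   = id , J-id
    ; pure-∘    = λ { {g = g} {f} (w₀ , p) (v₀ , q) →
                      w₀ ∘ v₀ ,
                      ≈-trans (J-∘ {g = w₀} {v₀})
                              (K.∘-cong {g = J w₀} {g} {J v₀} {f} p q) }
    }

  open WideSubcategory C public using (Pure; ι)

  private
    module C = Category (WideSubcategory.category C)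

  pure : ∀ {X Y} → Hom X Y → C.Hom X Y
  pure v₀ = J v₀ , v₀ , ≈-refl

  _₀ : ∀ {X Y} → C.Hom X Y → Hom X Y
  (_ , v₀ , _) ₀ = v₀

module KleisliProducts {o ℓ e : Level} {C₀ : Category o ℓ e} (cartesian₀ : Cartesian C₀)
  (strongMonad : StrongMonad cartesian₀)
  (η-mono : ∀ X → Category.Mono C₀ (StrongMonad.η strongMonad X)) where

  open Category C₀
  open Cartesian cartesian₀
  open StrongMonad strongMonad
  open Kleisli monad public

  private
    module C = Category (WideSubcategory.category C)

  ₀-cong : ∀ {X Y} {v v′ : C.Hom X Y} → v C.≈ v′ → v ₀ ≈ v′ ₀
  ₀-cong {v = _ , _ , p} {_ , _ , p′} v≈v′ =
    η-mono _ _ _ (≈-trans p (≈-trans v≈v′ (≈-sym p′)))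

  pure-₀ : ∀ {X Y} (v : C.Hom X Y) → pure (v ₀) C.≈ v
  pure-₀ (_ , _ , p) = p

  cartesian : Cartesian (WideSubcategory.category C)
  cartesian = record
    { terminal = record
        { 𝟙        = 𝟙
        ; !        = pure !
        ; !-unique = λ v → from₀ (pure !) v (!-unique (v ₀))
        }
    ; _⊗_      = _⊗_
    ; π₁       = pure π₁
    ; π₂       = pure π₂
    ; ⟨_,_⟩    = pair
    ; project₁ = λ {_} {_} {_} {f} {g} → from₀ (pure π₁ C.∘ pair f g) f project₁
    ; project₂ = λ {_} {_} {_} {f} {g} → from₀ (pure π₂ C.∘ pair f g) g project₂
    ; unique   = λ {_} {_} {_} {f} {g} {h} p q →
        from₀ (pair f g) h
          (unique (₀-cong {v = pure π₁ C.∘ h} {f} p) (₀-cong {v = pure π₂ C.∘ h} {g} q))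
    }
    where
    pair : ∀ {X Y Z} → C.Hom Z X → C.Hom Z Y → C.Hom Z (X ⊗ Y)
    pair f g = pure ⟨ f ₀ , g ₀ ⟩

    from₀ : ∀ {X Y} (v v′ : C.Hom X Y) → v ₀ ≈ v′ ₀ → v C.≈ v′
    from₀ v v′ p = ≈-trans (≈-sym (pure-₀ v)) (≈-trans (J-cong p) (pure-₀ v′))

  ⋉-Kl : LeftProduct C cartesian
  ⋉-Kl = record
    { _⋉_    = λ {_} {_} {Y₁} {Y₂} v f → ⟧ t Y₁ Y₂ ∘ (v ₀ ⊗₁ [ f ]) ⟦
    ; ⋉-cong = λ {_} {_} {_} {_} {v} {v′} p q →
        ∘-cong ≈-refl (⊗₁-cong (₀-cong {v = v} {v′} p) q)
    }

  ⋊-Kl : RightProduct C cartesian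
  ⋊-Kl = record
    { _⋊_    = λ {_} {_} {Y₁} {Y₂} f v → ⟧ t′ Y₁ Y₂ ∘ ([ f ] ⊗₁ v ₀) ⟦
    ; ⋊-cong = λ {_} {_} {_} {_} {_} {_} {v} {v′} p q →
        ∘-cong ≈-refl (⊗₁-cong p (₀-cong {v = v} {v′} q))
    }

module KleisliConsistency {o ℓ e r : Level} {C₀ : Category o ℓ e} (cartesian₀ : Cartesian C₀)
  (strongMonad : StrongMonad cartesian₀)
  (η-mono : ∀ X → Category.Mono C₀ (StrongMonad.η strongMonad X))
  (consistency : ConsistencyRelation (Kleisli.C (StrongMonad.monad strongMonad)) r) where

  open Category C₀
  open Cartesian cartesian₀
  open StrongMonad strongMonad
  open KleisliProducts cartesian₀ strongMonad η-mono public
  open Category K using () renaming (_∘_ to _∘ᴷ_)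
  open ConsistencyRelation consistency

  infix 4 _◁₀_ _◁▷₀_

  _◁₀_ : ∀ {X Y} → Hom X (M₀ Y) → Hom X (M₀ Y) → Set (ℓ ⊔ e ⊔ r)
  _◁₀_ {X} {Y} φ φ′ = Σ[ v₀ ∈ Hom X Y ] (φ′ ≈ η Y ∘ v₀) × (⟧ φ ⟦ ◁ J v₀)

  _◁▷₀_ : ∀ {X Y} → Hom X (M₀ Y) → Hom X (M₀ Y) → Set (ℓ ⊔ e ⊔ r)
  φ ◁▷₀ φ′ = ⟧ φ ⟦ ◁▷ ⟧ φ′ ⟦

  StrengthCondition : Obj → Obj → Set r
  StrengthCondition Y₁ Y₂ = J q₁ ∘ᴷ ⟧ t Y₁ Y₂ ⟦ ◁ J q₁′
    where
    q₁  = π₁ {Y₁} {Y₂}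
    q₁′ = π₁ {Y₁} {M₀ Y₂}

  StrengthCondition₀ : Obj → Obj → Set (ℓ ⊔ e ⊔ r)
  StrengthCondition₀ Y₁ Y₂ = M₁ q₁ ∘ t Y₁ Y₂ ◁₀ η Y₁ ∘ q₁′
    where
    q₁  = π₁ {Y₁} {Y₂}
    q₁′ = π₁ {Y₁} {M₀ Y₂}

  SeparationCondition : Obj → Obj → Obj → Set (ℓ ⊔ e ⊔ r)
  SeparationCondition X Y₁ Y₂ =
    (φ φ′ : Hom X (M₀ (Y₁ ⊗ Y₂))) →
    M₁ q₁ ∘ φ ◁▷₀ M₁ q₁ ∘ φ′ → M₁ q₂ ∘ φ ≈ M₁ q₂ ∘ φ′ → φ ≈ φ′
    where
    q₁ = π₁ {Y₁} {Y₂}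
    q₂ = π₂ {Y₁} {Y₂}

{-# OPTIONS --safe #-}
module Submission where

-- Pre- and postcomposing a Kleisli morphism f with pure ones is composing in
-- C₀:  [ J w ∘ f ∘ J v ] = M w ∘ [ f ] ∘ v.  So every condition on Kleisli
-- products becomes an equation or a consistency statement about the strength.
--
-- The strict halves of the product conditions always hold: M π₂ ∘ t = π₂, by
-- naturality of t along the map to 𝟙 and the unit axiom.  For the other half,
-- v ⋉ f = t ∘ (v₀ ⊗₁ [ f ]), so precomposing  J π₁ ∘ t ◁ J π₁  with the pure
-- morphism J (v₀ ⊗₁ [ f ]) gives  J π₁ ∘ (v ⋉ f) ◁ v ∘ J π₁;  conversely, t
-- is itself the left product of the identity of Y₁ with the Kleisli morphism
-- from M Y₂ to Y₂ given by the identity.  Right products are left products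
-- conjugated by swaps.
--
-- Separation says that a morphism into M (Y₁ ⊗ Y₂) is determined by its second
-- component and, up to consistency, its first; this is uniqueness of left
-- products, and uniqueness of right products after a swap.  It also yields
-- complementarity, applied to M ⟨ id , ! ⟩ ∘ φ and M ⟨ id , ! ⟩ ∘ φ′ in
-- M (Y ⊗ 𝟙), whose first components are φ and φ′ and whose second components
-- are the effects of φ and φ′.  Finally, products of pure morphisms agree with
-- those of C because t commutes with η.

open import Level using (Level)
open import Data.Product using (_×_; _,_)
open import Function.Bundles using (_⇔_; mk⇔)
open import Defs

-- Products and the swap isomorphism in a Cartesian category

module CartesianProperties {o ℓ e : Level} {C : Category o ℓ e} (cartesian : Cartesian C) where

  open Category C
  open Cartesian cartesian
  open HomReasoning

  ⟨⟩-unique : ∀ {X Y Z} {h h′ : Hom Z (X ⊗ Y)} →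
              π₁ ∘ h ≈ π₁ ∘ h′ → π₂ ∘ h ≈ π₂ ∘ h′ → h ≈ h′
  ⟨⟩-unique p q = ≈-trans (≈-sym (unique p q)) (unique ≈-refl ≈-refl)

  -- Reassociation after rewriting a composite of two morphisms.
  pullˡ : ∀ {W X Y Z} {a : Hom Y Z} {b : Hom X Y} {c : Hom X Z} {f : Hom W X} →
          a ∘ b ≈ c → a ∘ b ∘ f ≈ c ∘ f
  pullˡ p = ≈-trans (≈-sym assoc) (∘-cong p ≈-refl)

  ⊗₁-∘ : ∀ {X₁ X₂ Y₁ Y₂ Z₁ Z₂} {f : Hom X₁ Y₁} {g : Hom X₂ Y₂} {h : Hom Y₁ Z₁} {k : Hom Y₂ Z₂} →
         (h ⊗₁ k) ∘ (f ⊗₁ g) ≈ (h ∘ f) ⊗₁ (k ∘ g)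
  ⊗₁-∘ = ≈-sym (unique
    (≈-trans (pullˡ project₁) (≈-trans assoc (≈-trans (∘-cong ≈-refl project₁) (≈-sym assoc))))
    (≈-trans (pullˡ project₂) (≈-trans assoc (≈-trans (∘-cong ≈-refl project₂) (≈-sym assoc)))))

  ⊗₁-id : ∀ {X Y} → id {X} ⊗₁ id {Y} ≈ id
  ⊗₁-id = unique (≈-trans identityʳ (≈-sym identityˡ)) (≈-trans identityʳ (≈-sym identityˡ))

  swap-natural : ∀ {X₁ X₂ Y₁ Y₂} (f : Hom X₁ Y₁) (g : Hom X₂ Y₂) →
                 swap ∘ (f ⊗₁ g) ≈ (g ⊗₁ f) ∘ swap
  swap-natural f g = ⟨⟩-unique
    (begin
      π₁ ∘ swap ∘ (f ⊗₁ g)   ≈⟨ pullˡ project₁ ⟩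
      π₂ ∘ (f ⊗₁ g)          ≈⟨ project₂ ⟩
      g ∘ π₂                 ≈⟨ ∘-cong ≈-refl project₁ ⟨
      g ∘ π₁ ∘ swap          ≈⟨ assoc ⟨
      (g ∘ π₁) ∘ swap        ≈⟨ pullˡ project₁ ⟨
      π₁ ∘ (g ⊗₁ f) ∘ swap   ∎)
    (begin
      π₂ ∘ swap ∘ (f ⊗₁ g)   ≈⟨ pullˡ project₂ ⟩
      π₁ ∘ (f ⊗₁ g)          ≈⟨ project₁ ⟩
      f ∘ π₁                 ≈⟨ ∘-cong ≈-refl project₂ ⟨
      f ∘ π₂ ∘ swap          ≈⟨ assoc ⟨
      (f ∘ π₂) ∘ swap        ≈⟨ pullˡ project₂ ⟨
      π₂ ∘ (g ⊗₁ f) ∘ swap   ∎)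

  swap-involutive : ∀ {X Y} → swap {Y} {X} ∘ swap {X} {Y} ≈ id
  swap-involutive = ⟨⟩-unique
    (≈-trans (pullˡ project₁) (≈-trans project₂ (≈-sym identityʳ)))
    (≈-trans (pullˡ project₂) (≈-trans project₁ (≈-sym identityʳ)))

-- The strength and the projections, the unit and the swap

module StrengthProperties {o ℓ e : Level} {C₀ : Category o ℓ e} {cartesian₀ : Cartesian C₀}
  (strongMonad : StrongMonad cartesian₀) where

  open Category C₀
  open Cartesian cartesian₀
  open StrongMonad strongMonad
  open CartesianProperties cartesian₀
  open HomReasoning

  M-pullˡ : ∀ {W X Y Z} {g : Hom Y Z} {f : Hom X Y} {h : Hom X Z} {φ : Hom W (M₀ X)} →
            g ∘ f ≈ h → M₁ g ∘ M₁ f ∘ φ ≈ M₁ h ∘ φ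
  M-pullˡ p = pullˡ (≈-trans (≈-sym M-∘) (M-cong p))

  M-elim : ∀ {W X Y} {g : Hom Y X} {f : Hom X Y} {φ : Hom W (M₀ X)} →
           g ∘ f ≈ id → M₁ g ∘ M₁ f ∘ φ ≈ φ
  M-elim p = ≈-trans (M-pullˡ p) (≈-trans (∘-cong M-id ≈-refl) identityˡ)

  M-swap-injective : ∀ {W X Y} {φ φ′ : Hom W (M₀ (X ⊗ Y))} →
                     M₁ swap ∘ φ ≈ M₁ swap ∘ φ′ → φ ≈ φ′
  M-swap-injective p = ≈-trans (≈-sym (M-elim swap-involutive))
    (≈-trans (∘-cong ≈-refl p) (M-elim swap-involutive))

  -- The unit axiom gives this only for X = 𝟙; naturality along the map from X
  -- to 𝟙 transports it to every X.
  π₂-t : ∀ {X Y} → M₁ π₂ ∘ t X Y ≈ π₂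
  π₂-t {X} {Y} = begin
    M₁ π₂ ∘ t X Y                      ≈⟨ M-pullˡ (≈-trans project₂ identityˡ) ⟨
    M₁ π₂ ∘ M₁ (! ⊗₁ id) ∘ t X Y       ≈⟨ ∘-cong ≈-refl (t-natural ! id) ⟨
    M₁ π₂ ∘ t 𝟙 Y ∘ (! ⊗₁ M₁ id)       ≈⟨ pullˡ t-unit ⟩
    π₂ ∘ (! ⊗₁ M₁ id)                  ≈⟨ project₂ ⟩
    M₁ id ∘ π₂                         ≈⟨ ∘-cong M-id ≈-refl ⟩
    id ∘ π₂                            ≈⟨ identityˡ ⟩
    π₂                                 ∎

  π₂-t-⊗ : ∀ {X₁ X₂ Y₁ Y₂} (v : Hom X₁ Y₁) (φ : Hom X₂ (M₀ Y₂)) →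
           M₁ π₂ ∘ t Y₁ Y₂ ∘ (v ⊗₁ φ) ≈ φ ∘ π₂
  π₂-t-⊗ v φ = ≈-trans (pullˡ π₂-t) project₂

  t-⊗-η : ∀ {X₁ X₂ Y₁ Y₂} (v₁ : Hom X₁ Y₁) (v₂ : Hom X₂ Y₂) →
          t Y₁ Y₂ ∘ (v₁ ⊗₁ (η Y₂ ∘ v₂)) ≈ η (Y₁ ⊗ Y₂) ∘ (v₁ ⊗₁ v₂)
  t-⊗-η {Y₁ = Y₁} {Y₂} v₁ v₂ = begin
    t Y₁ Y₂ ∘ (v₁ ⊗₁ (η Y₂ ∘ v₂))          ≈⟨ ∘-cong ≈-refl (⊗₁-cong identityˡ ≈-refl) ⟨
    t Y₁ Y₂ ∘ ((id ∘ v₁) ⊗₁ (η Y₂ ∘ v₂))   ≈⟨ ∘-cong ≈-refl ⊗₁-∘ ⟨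
    t Y₁ Y₂ ∘ (id ⊗₁ η Y₂) ∘ (v₁ ⊗₁ v₂)    ≈⟨ pullˡ t-η ⟩
    η (Y₁ ⊗ Y₂) ∘ (v₁ ⊗₁ v₂)               ∎

  -- A right Kleisli product is a left one conjugated by swaps.
  t′-⊗ : ∀ {X₁ X₂ Y₁ Y₂} (φ : Hom X₁ (M₀ Y₁)) (v : Hom X₂ Y₂) →
         t′ Y₁ Y₂ ∘ (φ ⊗₁ v) ≈ M₁ swap ∘ (t Y₂ Y₁ ∘ (v ⊗₁ φ)) ∘ swap
  t′-⊗ {Y₁ = Y₁} {Y₂} φ v = begin
    (M₁ swap ∘ t Y₂ Y₁ ∘ swap) ∘ (φ ⊗₁ v)   ≈⟨ assoc ⟩
    M₁ swap ∘ (t Y₂ Y₁ ∘ swap) ∘ (φ ⊗₁ v)   ≈⟨ ∘-cong ≈-refl assoc ⟩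
    M₁ swap ∘ t Y₂ Y₁ ∘ swap ∘ (φ ⊗₁ v)     ≈⟨ ∘-cong ≈-refl (∘-cong ≈-refl (swap-natural φ v)) ⟩
    M₁ swap ∘ t Y₂ Y₁ ∘ (v ⊗₁ φ) ∘ swap     ≈⟨ ∘-cong ≈-refl assoc ⟨
    M₁ swap ∘ (t Y₂ Y₁ ∘ (v ⊗₁ φ)) ∘ swap   ∎

  π₁-t′-⊗ : ∀ {X₁ X₂ Y₁ Y₂} (φ : Hom X₁ (M₀ Y₁)) (v : Hom X₂ Y₂) →
            M₁ π₁ ∘ t′ Y₁ Y₂ ∘ (φ ⊗₁ v) ≈ φ ∘ π₁
  π₁-t′-⊗ {Y₁ = Y₁} {Y₂} φ v = begin
    M₁ π₁ ∘ t′ Y₁ Y₂ ∘ (φ ⊗₁ v)                      ≈⟨ ∘-cong ≈-refl (t′-⊗ φ v) ⟩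
    M₁ π₁ ∘ M₁ swap ∘ (t Y₂ Y₁ ∘ (v ⊗₁ φ)) ∘ swap    ≈⟨ M-pullˡ project₁ ⟩
    M₁ π₂ ∘ (t Y₂ Y₁ ∘ (v ⊗₁ φ)) ∘ swap              ≈⟨ pullˡ (π₂-t-⊗ v φ) ⟩
    (φ ∘ π₂) ∘ swap                                  ≈⟨ assoc ⟩
    φ ∘ π₂ ∘ swap                                    ≈⟨ ∘-cong ≈-refl project₂ ⟩
    φ ∘ π₁                                           ∎

  π₂-t′-⊗ : ∀ {X₁ X₂ Y₁ Y₂} (φ : Hom X₁ (M₀ Y₁)) (v : Hom X₂ Y₂) →
            M₁ π₂ ∘ t′ Y₁ Y₂ ∘ (φ ⊗₁ v) ≈ (M₁ π₁ ∘ t Y₂ Y₁) ∘ (v ⊗₁ φ) ∘ swap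
  π₂-t′-⊗ {Y₁ = Y₁} {Y₂} φ v = begin
    M₁ π₂ ∘ t′ Y₁ Y₂ ∘ (φ ⊗₁ v)                      ≈⟨ ∘-cong ≈-refl (t′-⊗ φ v) ⟩
    M₁ π₂ ∘ M₁ swap ∘ (t Y₂ Y₁ ∘ (v ⊗₁ φ)) ∘ swap    ≈⟨ M-pullˡ project₂ ⟩
    M₁ π₁ ∘ (t Y₂ Y₁ ∘ (v ⊗₁ φ)) ∘ swap              ≈⟨ ∘-cong ≈-refl assoc ⟩
    M₁ π₁ ∘ t Y₂ Y₁ ∘ (v ⊗₁ φ) ∘ swap                ≈⟨ assoc ⟨
    (M₁ π₁ ∘ t Y₂ Y₁) ∘ (v ⊗₁ φ) ∘ swap              ∎

  t′-η-⊗ : ∀ {X₁ X₂ Y₁ Y₂} (v₁ : Hom X₁ Y₁) (v₂ : Hom X₂ Y₂) →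
           t′ Y₁ Y₂ ∘ ((η Y₁ ∘ v₁) ⊗₁ v₂) ≈ η (Y₁ ⊗ Y₂) ∘ (v₁ ⊗₁ v₂)
  t′-η-⊗ {Y₁ = Y₁} {Y₂} v₁ v₂ = begin
    t′ Y₁ Y₂ ∘ ((η Y₁ ∘ v₁) ⊗₁ v₂)
      ≈⟨ t′-⊗ (η Y₁ ∘ v₁) v₂ ⟩
    M₁ swap ∘ (t Y₂ Y₁ ∘ (v₂ ⊗₁ (η Y₁ ∘ v₁))) ∘ swap
      ≈⟨ ∘-cong ≈-refl (∘-cong (t-⊗-η v₂ v₁) ≈-refl) ⟩
    M₁ swap ∘ (η (Y₂ ⊗ Y₁) ∘ (v₂ ⊗₁ v₁)) ∘ swap
      ≈⟨ ∘-cong ≈-refl assoc ⟩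
    M₁ swap ∘ η (Y₂ ⊗ Y₁) ∘ (v₂ ⊗₁ v₁) ∘ swap
      ≈⟨ pullˡ (≈-sym (η-natural swap)) ⟩
    (η (Y₁ ⊗ Y₂) ∘ swap) ∘ (v₂ ⊗₁ v₁) ∘ swap
      ≈⟨ assoc ⟩
    η (Y₁ ⊗ Y₂) ∘ swap ∘ (v₂ ⊗₁ v₁) ∘ swap
      ≈⟨ ∘-cong ≈-refl (∘-cong ≈-refl (swap-natural v₁ v₂)) ⟨
    η (Y₁ ⊗ Y₂) ∘ swap ∘ swap ∘ (v₁ ⊗₁ v₂)
      ≈⟨ ∘-cong ≈-refl (≈-trans (pullˡ swap-involutive) identityˡ) ⟩
    η (Y₁ ⊗ Y₂) ∘ (v₁ ⊗₁ v₂) ∎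

-- Kleisli products and consistency

module KleisliProductProperties {o ℓ e r : Level} {C₀ : Category o ℓ e}
  (cartesian₀ : Cartesian C₀) (strongMonad : StrongMonad cartesian₀)
  (η-mono : ∀ X → Category.Mono C₀ (StrongMonad.η strongMonad X))
  (consistency : ConsistencyRelation (Kleisli.C (StrongMonad.monad strongMonad)) r) where

  open Category C₀
  open Cartesian cartesian₀
  open StrongMonad strongMonad
  open CartesianProperties cartesian₀
  open StrengthProperties strongMonad
  open KleisliConsistency cartesian₀ strongMonad η-mono consistency
  open ConsistencyRelation consistency
  open HomReasoning
  private
    module K = Category K
    module C = Category (WideSubcategory.category C)

  open LeftProduct ⋉-Kl using (_⋉_)
  open RightProduct ⋊-Kl using (_⋊_)

  J-∘ˡ : ∀ {X Y Z} (w : Hom Y Z) (φ : Hom X (M₀ Y)) → [ J w K.∘ ⟧ φ ⟦ ] ≈ M₁ w ∘ φ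
  J-∘ˡ {Y = Y} {Z} w φ = begin
    μ Z ∘ M₁ (η Z ∘ w) ∘ φ         ≈⟨ ∘-cong ≈-refl (∘-cong M-∘ ≈-refl) ⟩
    μ Z ∘ (M₁ (η Z) ∘ M₁ w) ∘ φ    ≈⟨ ∘-cong ≈-refl assoc ⟩
    μ Z ∘ M₁ (η Z) ∘ M₁ w ∘ φ      ≈⟨ pullˡ μ-unitˡ ⟩
    id ∘ M₁ w ∘ φ                  ≈⟨ identityˡ ⟩
    M₁ w ∘ φ                       ∎

  J-∘ʳ : ∀ {X Y Z} (φ : Hom Y (M₀ Z)) (v : Hom X Y) → [ ⟧ φ ⟦ K.∘ J v ] ≈ φ ∘ v
  J-∘ʳ {Y = Y} {Z} φ v = begin
    μ Z ∘ M₁ φ ∘ η Y ∘ v       ≈⟨ ∘-cong ≈-refl (pullˡ (≈-sym (η-natural φ))) ⟩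
    μ Z ∘ (η (M₀ Z) ∘ φ) ∘ v   ≈⟨ ∘-cong ≈-refl assoc ⟩
    μ Z ∘ η (M₀ Z) ∘ φ ∘ v     ≈⟨ pullˡ μ-unitʳ ⟩
    id ∘ φ ∘ v                 ≈⟨ identityˡ ⟩
    φ ∘ v                      ∎

  pure-J : ∀ {X Y} (v : Hom X Y) → Pure (J v)
  pure-J v = v , ≈-refl

  ι-≈-J₀ : ∀ {X Y} (v : C.Hom X Y) → [ ι v ] ≈ [ J (v ₀) ]
  ι-≈-J₀ v = ≈-sym (pure-₀ v)

  ι-∘-J : ∀ {X Y Z} (v : C.Hom Y Z) (u : Hom X Y) → J (v ₀ ∘ u) K.≈ ι v K.∘ J u
  ι-∘-J v u = ≈-trans (J-∘ {g = v ₀} {f = u})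
    (K.∘-cong {g = J (v ₀)} {ι v} {J u} (pure-₀ v) ≈-refl)

  -- Consistency is stable under precomposition with pure morphisms; stated
  -- through representatives in C₀.
  ◁-∘-pure : ∀ {X Y Z} {φ : Hom Y (M₀ Z)} {w : Hom Y Z} (u : Hom X Y) →
             ⟧ φ ⟦ ◁ J w → ⟧ φ ∘ u ⟦ ◁ J (w ∘ u)
  ◁-∘-pure {φ = φ} {w} u p =
    ◁-resp (J-∘ʳ φ u) (≈-sym (J-∘ {g = w} {f = u}))
      (◁-∘ {f = J u} {⟧ φ ⟦} {K.id} {J u} {J w}
        (id , J-id) (pure-J u) (pure-J w)
        (◁-resp (≈-sym (K.identityˡ {f = J u})) ≈-refl (◁-refl (pure-J u)))
        (◁-resp ≈-refl (≈-sym (K.identityʳ {f = J w})) p))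

  strength⇔strength₀ : ∀ Y₁ Y₂ → StrengthCondition Y₁ Y₂ ⇔ StrengthCondition₀ Y₁ Y₂
  strength⇔strength₀ Y₁ Y₂ = mk⇔
    (λ s → π₁ , ≈-refl , ◁-resp (J-∘ˡ π₁ (t Y₁ Y₂)) ≈-refl s)
    (λ (v₀ , p , s) → ◁-resp (≈-sym (J-∘ˡ π₁ (t Y₁ Y₂))) (≈-sym p) s)

  -- The consistency half for f ⋊ v is the condition on t for the exchanged
  -- pair of objects, precomposed with a swap.
  strength⇒weakProducts : (∀ Y₁ Y₂ → StrengthCondition Y₁ Y₂) →
                          AreWeakProducts C cartesian consistency ⋉-Kl ⋊-Kl
  strength⇒weakProducts strength = record
    { ⋉-isProduct = λ {_} {_} {Y₁} {Y₂} v f →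
          ◁-resp (≈-trans assoc (≈-sym (J-∘ˡ π₁ [ v ⋉ f ])))
                 (≈-trans (J-cong project₁) (ι-∘-J v π₁))
                 (◁-∘-pure (v ₀ ⊗₁ [ f ]) (π₁-t-◁ Y₁ Y₂))
        , (begin
            [ J π₂ K.∘ (v ⋉ f) ]   ≈⟨ J-∘ˡ π₂ [ v ⋉ f ] ⟩
            M₁ π₂ ∘ [ v ⋉ f ]      ≈⟨ π₂-t-⊗ (v ₀) [ f ] ⟩
            [ f ] ∘ π₂             ≈⟨ J-∘ʳ [ f ] π₂ ⟨
            [ f K.∘ J π₂ ]         ∎)
    ; ⋊-isProduct = λ {_} {_} {Y₁} {Y₂} f v →
          (begin
            [ J π₁ K.∘ (f ⋊ v) ]   ≈⟨ J-∘ˡ π₁ [ f ⋊ v ] ⟩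
            M₁ π₁ ∘ [ f ⋊ v ]      ≈⟨ π₁-t′-⊗ [ f ] (v ₀) ⟩
            [ f ] ∘ π₁             ≈⟨ J-∘ʳ [ f ] π₁ ⟨
            [ f K.∘ J π₁ ]         ∎)
        , ◁-resp (≈-sym (≈-trans (J-∘ˡ π₂ [ f ⋊ v ]) (π₂-t′-⊗ [ f ] (v ₀))))
                 (≈-trans (J-cong (π₁-⊗-swap (v ₀) [ f ])) (ι-∘-J v π₂))
                 (◁-∘-pure ((v ₀ ⊗₁ [ f ]) ∘ swap) (π₁-t-◁ Y₂ Y₁))
    }
    where
    π₁-t-◁ : ∀ Y₁ Y₂ → ⟧ M₁ π₁ ∘ t Y₁ Y₂ ⟦ ◁ J π₁
    π₁-t-◁ Y₁ Y₂ = ◁-resp (J-∘ˡ π₁ (t Y₁ Y₂)) ≈-refl (strength Y₁ Y₂)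

    π₁-⊗-swap : ∀ {X₁ X₂ Y₁ Y₂} (v : Hom X₂ Y₂) (g : Hom X₁ Y₁) →
                π₁ ∘ (v ⊗₁ g) ∘ swap ≈ v ∘ π₂
    π₁-⊗-swap v g = ≈-trans (pullˡ project₁) (≈-trans assoc (∘-cong ≈-refl project₁))

  weakProducts⇒strength : AreWeakProducts C cartesian consistency ⋉-Kl ⋊-Kl →
                          ∀ Y₁ Y₂ → StrengthCondition Y₁ Y₂
  weakProducts⇒strength weak Y₁ Y₂ =
    -- t = id ⋉ ε, with ε : M Y₂ → Y₂ the Kleisli morphism given by the identity.
    let ε = ⟧ id {M₀ Y₂} ⟦
        id⋉ε≈t = ≈-trans (∘-cong ≈-refl ⊗₁-id) identityʳ
        (s , _) = AreWeakProducts.⋉-isProduct weak (pure id) ε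
    in ◁-resp
         (K.∘-cong {g = J π₁} {J π₁} {pure id ⋉ ε} {⟧ t Y₁ Y₂ ⟦} ≈-refl id⋉ε≈t)
         (≈-trans (≈-sym (ι-∘-J (pure id) π₁)) (J-cong identityˡ))
         s

  separation⇒effectCategory : (∀ X Y₁ Y₂ → SeparationCondition X Y₁ Y₂) →
                              IsEffectCategory C (Cartesian.terminal cartesian) consistency
  separation⇒effectCategory separation = record
    { complementarity = λ {X} {Y} f f′ same (v , pv , f◁v , f′◁v) →
        let graph : Hom X (M₀ Y) → Hom X (M₀ (Y ⊗ 𝟙))
            graph φ = M₁ ⟨ id , ! ⟩ ∘ φ
            -- The first component of graph φ is φ, the second is its effect.
            π₁-graph : ∀ φ → M₁ π₁ ∘ graph φ ≈ φ
            π₁-graph φ = M-elim project₁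
            π₂-graph : ∀ φ → M₁ π₂ ∘ graph φ ≈ [ J ! K.∘ ⟧ φ ⟦ ]
            π₂-graph φ = ≈-trans (M-pullˡ project₂) (≈-sym (J-∘ˡ ! φ))
            graphs-equal = separation X Y 𝟙 (graph [ f ]) (graph [ f′ ])
              ( v , pv , ◁-resp (≈-sym (π₁-graph [ f ])) ≈-refl f◁v
              , ◁-resp (≈-sym (π₁-graph [ f′ ])) ≈-refl f′◁v )
              (≈-trans (π₂-graph [ f ]) (≈-trans same (≈-sym (π₂-graph [ f′ ]))))
        in ≈-trans (≈-sym (π₁-graph [ f ]))
             (≈-trans (∘-cong ≈-refl graphs-equal) (π₁-graph [ f′ ]))
    }

  -- Two left products of the same pair have consistent first components and
  -- equal second ones; for right products the components are exchanged.
  left-unique : (∀ X Y₁ Y₂ → SeparationCondition X Y₁ Y₂) →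
                ∀ {X₁ X₂ Y₁ Y₂} (v : C.Hom X₁ Y₁) (f : K.Hom X₂ Y₂)
                (h h′ : K.Hom (X₁ ⊗ X₂) (Y₁ ⊗ Y₂)) →
                IsLeftProductOf C cartesian consistency ⋉-Kl ⋊-Kl v f h →
                IsLeftProductOf C cartesian consistency ⋉-Kl ⋊-Kl v f h′ → h K.≈ h′
  left-unique separation v f h h′ (c , q) (c′ , q′) =
    separation _ _ _ [ h ] [ h′ ]
      ( _ , ◁-pure c , ◁-resp (J-∘ˡ π₁ [ h ]) ≈-refl c , ◁-resp (J-∘ˡ π₁ [ h′ ]) ≈-refl c′ )
      (begin
        M₁ π₂ ∘ [ h ]        ≈⟨ J-∘ˡ π₂ [ h ] ⟨
        [ J π₂ K.∘ h ]       ≈⟨ q ⟩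
        [ f K.∘ J π₂ ]       ≈⟨ q′ ⟨
        [ J π₂ K.∘ h′ ]      ≈⟨ J-∘ˡ π₂ [ h′ ] ⟩
        M₁ π₂ ∘ [ h′ ]       ∎)

  right-unique : (∀ X Y₁ Y₂ → SeparationCondition X Y₁ Y₂) →
                 ∀ {X₁ X₂ Y₁ Y₂} (f : K.Hom X₁ Y₁) (v : C.Hom X₂ Y₂)
                 (h h′ : K.Hom (X₁ ⊗ X₂) (Y₁ ⊗ Y₂)) →
                 IsRightProductOf C cartesian consistency ⋉-Kl ⋊-Kl f v h →
                 IsRightProductOf C cartesian consistency ⋉-Kl ⋊-Kl f v h′ → h K.≈ h′
  right-unique separation f v h h′ (q , c) (q′ , c′) =
    M-swap-injective (separation _ _ _ (M₁ swap ∘ [ h ]) (M₁ swap ∘ [ h′ ])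
      ( _ , ◁-pure c , ◁-resp (first h) ≈-refl c , ◁-resp (first h′) ≈-refl c′ )
      (≈-trans (≈-sym (second h)) (≈-trans q (≈-trans (≈-sym q′) (second h′)))))
    where
    first : ∀ {X Y₁ Y₂} (k : K.Hom X (Y₁ ⊗ Y₂)) → [ J π₂ K.∘ k ] ≈ M₁ π₁ ∘ M₁ swap ∘ [ k ]
    first k = ≈-trans (J-∘ˡ π₂ [ k ]) (≈-sym (M-pullˡ project₁))

    second : ∀ {X Y₁ Y₂} (k : K.Hom X (Y₁ ⊗ Y₂)) → [ J π₁ K.∘ k ] ≈ M₁ π₂ ∘ M₁ swap ∘ [ k ]
    second k = ≈-trans (J-∘ˡ π₁ [ k ]) (≈-sym (M-pullˡ project₂))

  separation⇒cartesianEffectCategory :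
    (∀ Y₁ Y₂ → StrengthCondition Y₁ Y₂) → (∀ X Y₁ Y₂ → SeparationCondition X Y₁ Y₂) →
    IsCartesianEffectCategory C cartesian consistency ⋉-Kl ⋊-Kl
  separation⇒cartesianEffectCategory strength separation = record
    { isWeakCartesianEffectCategory = record
        { isEffectCategory = separation⇒effectCategory separation
        ; areWeakProducts  = weak
        }
    ; ⋉-extends-⊗ = λ v₁ v₂ →
        ≈-trans (∘-cong ≈-refl (⊗₁-cong ≈-refl (ι-≈-J₀ v₂))) (t-⊗-η (v₁ ₀) (v₂ ₀))
    ; ⋊-extends-⊗ = λ v₁ v₂ →
        ≈-trans (∘-cong ≈-refl (⊗₁-cong (ι-≈-J₀ v₁) ≈-refl)) (t′-η-⊗ (v₁ ₀) (v₂ ₀))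
    ; ⋉-unique = λ v f h p →
        left-unique separation v f h (v ⋉ f) p (AreWeakProducts.⋉-isProduct weak v f)
    ; ⋊-unique = λ f v h p →
        right-unique separation f v h (f ⋊ v) p (AreWeakProducts.⋊-isProduct weak f v)
    }
    where
    weak = strength⇒weakProducts strength

theorem19 :
    ∀ {o ℓ e r : Level} {C₀ : Category o ℓ e} (cartesian₀ : Cartesian C₀)
      (M : StrongMonad cartesian₀)
      (η-mono : ∀ X → Category.Mono C₀ (StrongMonad.η M X))
      (consistency : ConsistencyRelation (Kleisli.C (StrongMonad.monad M)) r) →
    let open KleisliConsistency cartesian₀ M η-mono consistency in
    -- Complementarity is part of the notion of an effect category; it does not
    -- follow from the strength condition (take the identity monad, and let
    -- every morphism be consistent with every pure one).
    ( IsEffectCategory C (Cartesian.terminal cartesian) consistency →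
      IsWeakCartesianEffectCategory C cartesian consistency ⋉-Kl ⋊-Kl
      ⇔ (∀ Y₁ Y₂ → StrengthCondition Y₁ Y₂) )
    -- The same equivalence for an arbitrary consistency relation, with
    -- complementarity left out of the left-hand side.
    × ( AreWeakProducts C cartesian consistency ⋉-Kl ⋊-Kl
        ⇔ (∀ Y₁ Y₂ → StrengthCondition Y₁ Y₂) )
    × ( ∀ Y₁ Y₂ → StrengthCondition Y₁ Y₂ ⇔ StrengthCondition₀ Y₁ Y₂ )
    × ( (∀ Y₁ Y₂ → StrengthCondition Y₁ Y₂) →
        (∀ X Y₁ Y₂ → SeparationCondition X Y₁ Y₂) →
        IsCartesianEffectCategory C cartesian consistency ⋉-Kl ⋊-Kl )
theorem19 cartesian₀ M η-mono consistency =
    (λ effect → mk⇔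
      (λ weak → weakProducts⇒strength (IsWeakCartesianEffectCategory.areWeakProducts weak))
      (λ strength → record
        { isEffectCategory = effect
        ; areWeakProducts  = strength⇒weakProducts strength
        }))
  , mk⇔ weakProducts⇒strength strength⇒weakProducts
  , strength⇔strength₀
  , separation⇒cartesianEffectCategory
  where
  open KleisliProductProperties cartesian₀ M η-mono consistency
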